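{- Let $\Gamma$ be a metrized graph with vertex set $V(\Gamma)$ and edge set $E(\Gamma)$, with voltage function $j_z(x,y)$ and resistance function $r(x,y)$. Let $e_i \in E(\Gamma)$ be an edge of length $L_i$ with end points $p_i$ and $q_i$, and let $e_j \in E(\Gamma)$ be an edge of length $L_j$ with end points $p_j$ and $q_j$. Suppose the edges $e_i$ and $e_j$ are distinct, but their end points are not necessarily distinct. If $x$ belongs to the edge $e_i$ and $y$ belongs to the edge $e_j$, then $$\begin{aligned} r(x,y) &= -x^2\, \frac{L_i - r(p_i,q_i)}{L_i^2}-y^2\, \frac{L_j - r(p_j,q_j)}{L_j^2} +\frac{2xy}{L_i L_j} \big(j_{p_j}(p_i,q_j)-j_{p_j}(q_i,q_j)\big)\\ & \qquad +\frac{x}{L_i} \big(L_i-2j_{p_i}(q_i,p_j)\big) +\frac{y}{L_j} \big(L_j-2j_{p_j}(p_i,q_j)\big) +r(p_i,p_j), \end{aligned}$$ where on the right-hand side $x\in[0,L_i]$ and $y\in[0,L_j]$ denote the parameters of the points $x\in e_i$ and $y\in e_j$.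
   Context: A metrized graph $\Gamma$ is a finite connected graph whose edges are equipped with a distinguished parametrization by line segments (multiple edges and self-loops are allowed). The valence of $p\in\Gamma$ is the number of directions emanating from $p$. A vertex set $V(\Gamma)$ is a finite non-empty subset of $\Gamma$ containing every point of valence $\neq 2$ (additional points of valence 2 may be included). The set $E(\Gamma)$ of edges is the set of closed line segments with end points in $V(\Gamma)$ into which $V(\Gamma)$ divides $\Gamma$; the length of $e_i$ is a positive real number $L_i$. Parametrization convention: an edge $e_i$ of length $L_i$ with end points $p_i,q_i$ is identified with $[0,L_i]$ so that $p_i$ corresponds to $0$ and $q_i$ to $L_i$ (likewise for $e_j$). A point of an edge and the corresponding real number are denoted by the same letter: in the arguments of $r$ and $j$ the letters denote points of $\Gamma$, elsewhere in formulas they denote the real parameters. Voltage and resistance functions: view $\Gamma$ as a resistive electric circuit in which each edge has resistance equal to its length. For $x,y,z\in\Gamma$, $j_z(x,y)$ is the voltage difference between $x$ and $z$ when unit current enters at $y$ and exits at $z$ (with reference voltage $0$ at $z$). Equivalently, for fixed $y,z$, $x\mapsto j_z(x,y)$ is the unique continuous piecewise affine function $f$ on $\Gamma$ with $f(z)=0$ and $\Delta f=\delta_y-\delta_z$, where $\Delta f=-\sum_{p}\sigma_p(f)\,\delta_p$ and $\sigma_p(f)$ is the sum of the slopes of $f$ in all directions emanating from $p$. The resistance function is $r(x,y)=j_y(x,x)$, the effective resistance between $x$ and $y$. -}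

module Defs where

open import Level using (Level; _⊔_) renaming (suc to lsuc)
open import Algebra.Bundles using (CommutativeRing)
open import Data.Bool.Base using (if_then_else_)
open import Data.Fin.Base using (Fin)
import Data.Fin.Properties as Fin
open import Data.Nat.Base using (ℕ; NonZero)
open import Data.Product.Base using (Σ-syntax; ∃-syntax; _×_)
open import Relation.Binary.Construct.Closure.Equivalence using (EqClosure)
import Relation.Binary.Construct.StrictToNonStrict as ToNonStrict
open import Relation.Binary.Core using (Rel)
open import Relation.Binary.Definitions using (Decidable; tri<; tri≈; tri>)
open import Relation.Binary.PropositionalEquality.Core using (_≡_)
open import Relation.Binary.Structures using (IsStrictTotalOrder)
open import Relation.Nullary.Decidable.Core using (yes; no; does)
open import Relation.Nullary.Negation.Core using (¬_)

-- Totally ordered fields, with trichotomy of the order as in the classical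
-- theory of ℝ.  The inverse is total; its value at 0# is unspecified.
record OrderedField c ℓ₁ ℓ₂ : Set (lsuc (c ⊔ ℓ₁ ⊔ ℓ₂)) where
  field
    commutativeRing : CommutativeRing c ℓ₁
  open CommutativeRing commutativeRing public
    hiding (refl; sym; trans; reflexive; isEquivalence; isPartialEquivalence)
  infix 4 _<_
  infix 8 _⁻¹
  field
    _<_                : Rel Carrier ℓ₂
    isStrictTotalOrder : IsStrictTotalOrder _≈_ _<_
    +-monoˡ-<          : ∀ {x y} z → x < y → x + z < y + z
    *-pos              : ∀ {x y} → 0# < x → 0# < y → 0# < x * y
    0≉1                : ¬ (0# ≈ 1#)
    _⁻¹                : Carrier → Carrier
    ⁻¹-inverseʳ        : ∀ x → ¬ (x ≈ 0#) → x * x ⁻¹ ≈ 1#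

  open IsStrictTotalOrder isStrictTotalOrder public using (compare; _≟_)
  open ToNonStrict _≈_ _<_ public using (_≤_)
  open import Algebra.Properties.CommutativeMonoid.Sum +-commutativeMonoid public
    using (sum)

  infixl 7 _/_
  _/_ : Carrier → Carrier → Carrier
  x / y = x * y ⁻¹

  2# : Carrier
  2# = 1# + 1#

private
  variable
    c ℓ₁ ℓ₂ : Level

-- A metrized graph together with a choice of vertex set, presented by its
-- edges: edge e is a copy of [0 , L e] with 0 glued to the vertex p e and L e
-- glued to q e.  Multiple edges and self-loops are allowed.
record MetrizedGraph (K : OrderedField c ℓ₁ ℓ₂) : Set (c ⊔ ℓ₂) where
  open OrderedField K
  field
    #vertices #edges : ℕ
    nonEmpty         : NonZero #vertices

  Vertex : Set
  Vertex = Fin #vertices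

  Edge : Set
  Edge = Fin #edges

  field
    p q       : Edge → Vertex
    L         : Edge → Carrier
    L>0       : ∀ e → 0# < L e
    connected : ∀ u v → EqClosure (λ v₁ v₂ → ∃[ e ] (v₁ ≡ p e × v₂ ≡ q e)) u v

-- Piecewise affine functions on the closed interval [a , b].  The pieces are
-- closed intervals sharing their end points, so g is also continuous.
module _ (K : OrderedField c ℓ₁ ℓ₂) where
  open OrderedField K

  data PiecewiseAffineOn (g : Carrier → Carrier) :
                         (a b : Carrier) → Set (c ⊔ ℓ₁ ⊔ ℓ₂) where
    affine : ∀ {a b} (s : Carrier) →
             (∀ t → a ≤ t → t ≤ b → g t ≈ g a + s * (t - a)) →
             PiecewiseAffineOn g a b
    join   : ∀ {a b} (m : Carrier) → a < m → m < b →
             PiecewiseAffineOn g a m → PiecewiseAffineOn g m b →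
             PiecewiseAffineOn g a b

module Circuit {K : OrderedField c ℓ₁ ℓ₂} (Γ : MetrizedGraph K) where
  open OrderedField K
  open MetrizedGraph Γ

  data Point : Set (c ⊔ ℓ₂) where
    vertex   : Vertex → Point
    interior : (e : Edge) (t : Carrier) → 0# < t → t < L e → Point

  infix 4 _≈ₚ_ _≟ₚ_

  data _≈ₚ_ : Rel Point (c ⊔ ℓ₁ ⊔ ℓ₂) where
    vertex   : ∀ {u v} → u ≡ v → vertex u ≈ₚ vertex v
    interior : ∀ {e e′ s t 0<s s<L 0<t t<L} → e ≡ e′ → s ≈ t →
               interior e s 0<s s<L ≈ₚ interior e′ t 0<t t<L

  _≟ₚ_ : Decidable _≈ₚ_
  vertex u         ≟ₚ vertex v         with u Fin.≟ v
  ... | yes u≡v = yes (vertex u≡v)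
  ... | no  u≢v = no λ { (vertex u≡v) → u≢v u≡v }
  vertex _         ≟ₚ interior _ _ _ _ = no λ ()
  interior _ _ _ _ ≟ₚ vertex _         = no λ ()
  interior e s _ _ ≟ₚ interior e′ t _ _ with e Fin.≟ e′ | s ≟ t
  ... | yes e≡e′ | yes s≈t = yes (interior e≡e′ s≈t)
  ... | yes _    | no  s≉t = no λ { (interior _ s≈t) → s≉t s≈t }
  ... | no  e≢e′ | _       = no λ { (interior e≡e′ _) → e≢e′ e≡e′ }

  -- The point of the closed edge e with parameter t ∈ [0 , L e].  Parameters
  -- outside this interval are sent to the nearer end point; such values are
  -- never used.
  at : Edge → Carrier → Point
  at e t with compare 0# t | compare t (L e)
  ... | tri< 0<t _ _ | tri< t<L _ _ = interior e t 0<t t<L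
  ... | tri< _ _ _   | tri≈ _ _ _   = vertex (q e)
  ... | tri< _ _ _   | tri> _ _ _   = vertex (q e)
  ... | tri≈ _ _ _   | _            = vertex (p e)
  ... | tri> _ _ _   | _            = vertex (p e)

  record ContinuousPiecewiseAffine (f : Point → Carrier) :
                                   Set (c ⊔ ℓ₁ ⊔ ℓ₂) where
    field
      cong            : ∀ {P Q} → P ≈ₚ Q → f P ≈ f Q
      piecewiseAffine : ∀ e → PiecewiseAffineOn K (λ t → f (at e t)) 0# (L e)

  -- s is the slope of f at the point of e with parameter t in the direction
  -- of increasing, respectively decreasing, parameter.
  Slope⁺ Slope⁻ : (Point → Carrier) → Edge → Carrier → Carrier → Set (c ⊔ ℓ₁ ⊔ ℓ₂)
  Slope⁺ f e t s = Σ[ ε ∈ Carrier ] (0# < ε × t + ε ≤ L e ×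
    (∀ h → 0# ≤ h → h ≤ ε → f (at e (t + h)) ≈ f (at e t) + s * h))
  Slope⁻ f e t s = Σ[ ε ∈ Carrier ] (0# < ε × ε ≤ t ×
    (∀ h → 0# ≤ h → h ≤ ε → f (at e (t - h)) ≈ f (at e t) + s * h))

  -- IsSlopeSum f P σ says that σ = σ_P(f), the sum of the slopes of f in all
  -- directions emanating from P.  A self-loop contributes two directions at
  -- its vertex.
  IsSlopeSum : (Point → Carrier) → Point → Carrier → Set (c ⊔ ℓ₁ ⊔ ℓ₂)
  IsSlopeSum f (vertex v) σ =
    Σ[ s⁺ ∈ (Edge → Carrier) ] Σ[ s⁻ ∈ (Edge → Carrier) ]
      ((∀ e → p e ≡ v → Slope⁺ f e 0# (s⁺ e)) ×
       (∀ e → q e ≡ v → Slope⁻ f e (L e) (s⁻ e)) ×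
       σ ≈ sum (λ e → if does (p e Fin.≟ v) then s⁺ e else 0#)
         + sum (λ e → if does (q e Fin.≟ v) then s⁻ e else 0#))
  IsSlopeSum f (interior e t _ _) σ =
    Σ[ s⁺ ∈ Carrier ] Σ[ s⁻ ∈ Carrier ]
      (Slope⁺ f e t s⁺ × Slope⁻ f e t s⁻ × σ ≈ s⁺ + s⁻)

  -- Discrete measures on Γ are represented by the mass of each point.
  δ : Point → Point → Carrier
  δ y P = if does (P ≟ₚ y) then 1# else 0#

  HasLaplacian : (Point → Carrier) → (Point → Carrier) → Set (c ⊔ ℓ₁ ⊔ ℓ₂)
  HasLaplacian f μ = ∀ P → IsSlopeSum f P (- μ P)

  -- j z x y stands for j_z(x , y).
  record IsVoltageFunction (j : Point → Point → Point → Carrier) :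
                           Set (c ⊔ ℓ₁ ⊔ ℓ₂) where
    field
      continuousPiecewiseAffine :
        ∀ z y → ContinuousPiecewiseAffine (λ x → j z x y)
      reference : ∀ z y → j z z y ≈ 0#
      laplacian : ∀ z y → HasLaplacian (λ x → j z x y) (λ P → δ y P - δ z P)

  resistance : (Point → Point → Point → Carrier) → Point → Point → Carrier
  resistance j x y = j y x x

-- Let F = j_y(·, x) with x on eᵢ and y on eⱼ, and let φ̃ denote the function
-- that agrees with φ at the vertices and is affine on every edge.  On each edge
-- F is affine except for a kink of mass ±1 at an interior source or sink, so
-- summation by parts gives, for every φ on the vertices,
--   Σₑ (φ(qₑ) - φ(pₑ)) (F(qₑ) - F(pₑ)) / Lₑ = φ̃(x) - φ̃(y).
-- The left side is symmetric in φ and F.  Taking φ = j_o(·, v) for vertices o, v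
-- yields the reciprocity F(v) - F(o) = φ̃(x) - φ̃(y), which expresses F at the
-- vertices through voltages between vertices.  Finally
-- F(x) = F̃(x) + x (Lᵢ - x) / Lᵢ and F(y) = F̃(y) - y (Lⱼ - y) / Lⱼ, while r(x, y) = F(x) - F(y).

module Submission where

open import Defs
open import Algebra.Bundles using (CommutativeMonoid; CommutativeRing)
import Algebra.Solver.Ring as RingSolver
import Algebra.Solver.Ring.AlmostCommutativeRing as ACR
open import Data.Bool.Base using (if_then_else_)
open import Data.Fin.Base using (Fin; zero; suc)
import Data.Fin.Properties as Fin
open import Data.Integer.Base as ℤ using (ℤ; +_; -[1+_]; +0)
import Data.Integer.Properties as ℤ
open import Data.Maybe.Base as Maybe using (Maybe)
open import Data.Nat.Base as ℕ using (ℕ; zero; suc)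
import Data.Nat.Properties as ℕ
open import Data.Product.Base using (_×_; _,_; Σ-syntax; ∃-syntax; proj₁; proj₂)
import Data.Sign.Base as Sign
open import Data.Sum.Base using (inj₁; inj₂)
open import Function.Base using (_∘_)
open import Level using (_⊔_)
import Relation.Binary.Construct.StrictToNonStrict as ToNonStrict
open import Relation.Binary.Definitions using (tri<; tri≈; tri>)
import Relation.Binary.PropositionalEquality.Core as ≡
open import Relation.Binary.PropositionalEquality.Core using (_≡_; _≢_)
open import Relation.Binary.Structures using (IsStrictTotalOrder)
open import Relation.Nullary.Decidable.Core using (Dec; yes; no; does; dec⇒maybe)
open import Relation.Nullary.Negation.Core using (¬_; contradiction)

-- Integer coefficients for the ring solver.

module IntegerCoefficients {c ℓ} (R : CommutativeRing c ℓ) where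
  open CommutativeRing R
  open import Algebra.Properties.Ring ring
  open import Algebra.Properties.AbelianGroup +-abelianGroup using (⁻¹-∙-comm)
  open import Algebra.Properties.Semiring.Mult.TCOptimised semiring
    using (×-homo-+; ×1-homo-*) renaming (_×_ to _·_)
  open import Algebra.Properties.CommutativeSemigroup
    (CommutativeMonoid.commutativeSemigroup +-commutativeMonoid) using (interchange)
  open import Relation.Binary.Reasoning.Setoid setoid

  fromℤ : ℤ → Carrier
  fromℤ (+ n)    = n · 1#
  fromℤ -[1+ n ] = - (suc n · 1#)

  -- Mixed-sign sums of integers compute to `⊖`. The recursion removes one unit from both arguments,
  -- and the inserted `1# - 1#` gives it back to the two terms.
  fromℤ-⊖ : ∀ m n → fromℤ (m ℤ.⊖ n) ≈ m · 1# - n · 1#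
  fromℤ-⊖ m       zero    = sym (trans (+-congˡ -0#≈0#) (+-identityʳ _))
  fromℤ-⊖ zero    (suc n) = sym (+-identityˡ _)
  fromℤ-⊖ (suc m) (suc n) = begin
    fromℤ (suc m ℤ.⊖ suc n)               ≡⟨ ≡.cong fromℤ (ℤ.[1+m]⊖[1+n]≡m⊖n m n) ⟩
    fromℤ (m ℤ.⊖ n)                       ≈⟨ fromℤ-⊖ m n ⟩
    m · 1# - n · 1#                       ≈⟨ +-identityˡ _ ⟨
    0# + (m · 1# - n · 1#)                ≈⟨ +-congʳ (-‿inverseʳ 1#) ⟨
    (1# - 1#) + (m · 1# - n · 1#)         ≈⟨ interchange _ _ _ _ ⟩
    (1# + m · 1#) + (- 1# + - (n · 1#))   ≈⟨ +-congˡ (⁻¹-∙-comm _ _) ⟩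
    (1# + m · 1#) - (1# + n · 1#)
      ≈⟨ +-cong (×-homo-+ 1# 1 m) (-‿cong (×-homo-+ 1# 1 n)) ⟨
    suc m · 1# - suc n · 1#               ∎

  fromℤ-neg : ∀ i → fromℤ (ℤ.- i) ≈ - fromℤ i
  fromℤ-neg +0          = sym -0#≈0#
  fromℤ-neg (+ suc n)   = refl
  fromℤ-neg -[1+ n ]    = sym (-‿involutive _)

  fromℤ-+ : ∀ i j → fromℤ (i ℤ.+ j) ≈ fromℤ i + fromℤ j
  fromℤ-+ (+ m)    (+ n)    = ×-homo-+ 1# m n
  fromℤ-+ (+ m)    -[1+ n ] = fromℤ-⊖ m (suc n)
  fromℤ-+ -[1+ m ] (+ n)    = trans (fromℤ-⊖ n (suc m)) (+-comm _ _)
  fromℤ-+ -[1+ m ] -[1+ n ] = begin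
    - (suc (suc (m ℕ.+ n)) · 1#)    ≡⟨ ≡.cong (λ k → - (suc k · 1#)) (ℕ.+-suc m n) ⟨
    - ((suc m ℕ.+ suc n) · 1#)      ≈⟨ -‿cong (×-homo-+ 1# (suc m) (suc n)) ⟩
    - (suc m · 1# + suc n · 1#)     ≈⟨ ⁻¹-∙-comm _ _ ⟨
    - (suc m · 1#) - suc n · 1#     ∎

  -- Mixed-sign products compute to `Sign.- ℤ.◃ n`, which is `+0` at n = 0 and a negative integer
  -- otherwise; hence the case split.
  fromℤ-◃ : ∀ n → fromℤ (Sign.- ℤ.◃ n) ≈ - (n · 1#)
  fromℤ-◃ zero    = sym -0#≈0#
  fromℤ-◃ (suc n) = refl

  fromℤ-* : ∀ i j → fromℤ (i ℤ.* j) ≈ fromℤ i * fromℤ j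
  fromℤ-* (+ m)    (+ n)    = trans (reflexive (≡.cong fromℤ (ℤ.+◃n≡+n (m ℕ.* n)))) (×1-homo-* m n)
  fromℤ-* (+ m)    -[1+ n ] = begin
    fromℤ (Sign.- ℤ.◃ (m ℕ.* suc n))  ≈⟨ fromℤ-◃ (m ℕ.* suc n) ⟩
    - ((m ℕ.* suc n) · 1#)            ≈⟨ -‿cong (×1-homo-* m (suc n)) ⟩
    - (m · 1# * (suc n · 1#))         ≈⟨ -‿distribʳ-* _ _ ⟩
    m · 1# * - (suc n · 1#)           ∎
  fromℤ-* -[1+ m ] (+ n)    = begin
    fromℤ (Sign.- ℤ.◃ (suc m ℕ.* n))  ≈⟨ fromℤ-◃ (suc m ℕ.* n) ⟩
    - ((suc m ℕ.* n) · 1#)            ≈⟨ -‿cong (×1-homo-* (suc m) n) ⟩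
    - (suc m · 1# * (n · 1#))         ≈⟨ -‿distribˡ-* _ _ ⟩
    - (suc m · 1#) * (n · 1#)         ∎
  fromℤ-* -[1+ m ] -[1+ n ] = begin
    (suc m ℕ.* suc n) · 1#            ≈⟨ ×1-homo-* (suc m) (suc n) ⟩
    suc m · 1# * (suc n · 1#)         ≈⟨ -‿involutive _ ⟨
    - - (suc m · 1# * (suc n · 1#))   ≈⟨ -‿cong (-‿distribˡ-* _ _) ⟩
    - (- (suc m · 1#) * (suc n · 1#)) ≈⟨ -‿distribʳ-* _ _ ⟩
    - (suc m · 1#) * - (suc n · 1#)   ∎

  homomorphism : ℤ.+-*-rawRing ACR.-Raw-AlmostCommutative⟶ ACR.fromCommutativeRing R
  homomorphism = record
    { ⟦_⟧    = fromℤ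
    ; +-homo = fromℤ-+
    ; *-homo = fromℤ-*
    ; -‿homo = fromℤ-neg
    ; 0-homo = refl
    ; 1-homo = refl
    }

  -- Only positive answers are reported, because distinct integers can have equal images in a
  -- general commutative ring.
  fromℤ-≟ : ∀ i j → Maybe (fromℤ i ≈ fromℤ j)
  fromℤ-≟ i j = Maybe.map (λ i≡j → reflexive (≡.cong fromℤ i≡j)) (dec⇒maybe (i ℤ.≟ j))

  -- Coefficients in ℤ rather than in the carrier make the cancellation of
  -- x - x decidable by computation.
  module Solver =
    RingSolver ℤ.+-*-rawRing (ACR.fromCommutativeRing R) homomorphism fromℤ-≟

-- Order, cancellation and inverses in an ordered field.

module OrderedFieldProperties {c ℓ₁ ℓ₂} (K : OrderedField c ℓ₁ ℓ₂) where
  open OrderedField K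
  open CommutativeRing commutativeRing using (refl; sym; trans; isEquivalence)
  open IsStrictTotalOrder isStrictTotalOrder
    using (irrefl; <-respʳ-≈; <-respˡ-≈; <-resp-≈) renaming (trans to <-trans)
  open IntegerCoefficients commutativeRing using (module Solver)
  open Solver using (solve; _:=_; _:+_; _:*_; _:-_; :-_; con)
  open import Relation.Binary.Reasoning.Setoid setoid

  module ≤ = ToNonStrict _≈_ _<_

  ≤-refl : ∀ {x} → x ≤ x
  ≤-refl = inj₂ refl

  ≤-trans : ∀ {x y z} → x ≤ y → y ≤ z → x ≤ z
  ≤-trans = ≤.trans isEquivalence <-resp-≈ <-trans

  ≤-<-trans : ∀ {x y z} → x ≤ y → y < z → x < z
  ≤-<-trans = ≤.≤-<-trans sym <-trans <-respˡ-≈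

  <-≤-trans : ∀ {x y z} → x < y → y ≤ z → x < z
  <-≤-trans = ≤.<-≤-trans <-trans <-respʳ-≈

  ≤⇒≯ : ∀ {x y} → x ≤ y → ¬ (y < x)
  ≤⇒≯ x≤y y<x = irrefl refl (≤-<-trans x≤y y<x)

  +-monoˡ-≤ : ∀ {x y} z → x ≤ y → x + z ≤ y + z
  +-monoˡ-≤ z (inj₁ x<y) = inj₁ (+-monoˡ-< z x<y)
  +-monoˡ-≤ z (inj₂ x≈y) = inj₂ (+-congʳ x≈y)

  x<y⇒0<y-x : ∀ {x y} → x < y → 0# < y - x
  x<y⇒0<y-x {x} x<y = <-respˡ-≈ (-‿inverseʳ x) (+-monoˡ-< (- x) x<y)

  x≤y⇒0≤y-x : ∀ {x y} → x ≤ y → 0# ≤ y - x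
  x≤y⇒0≤y-x (inj₁ x<y)     = inj₁ (x<y⇒0<y-x x<y)
  x≤y⇒0≤y-x {x} (inj₂ x≈y) = inj₂ (trans (sym (-‿inverseʳ x)) (+-congʳ x≈y))

  0≤y-x⇒x≤y : ∀ {x y} → 0# ≤ y - x → x ≤ y
  0≤y-x⇒x≤y {x} {y} 0≤y-x = ≤-trans (inj₂ (sym (+-identityˡ x)))
    (≤-trans (+-monoˡ-≤ x 0≤y-x)
             (inj₂ (solve 2 (λ x y → y :- x :+ x := y) refl x y)))

  positive-lower-bound : ∀ {x y} → 0# < x → 0# < y →
                         ∃[ z ] (0# < z × z ≤ x × z ≤ y)
  positive-lower-bound {x} {y} 0<x 0<y with compare x y
  ... | tri< x<y _ _ = x , 0<x , ≤-refl , inj₁ x<y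
  ... | tri≈ _ x≈y _ = x , 0<x , ≤-refl , inj₂ x≈y
  ... | tri> _ _ y<x = y , 0<y , inj₁ y<x , ≤-refl

  0<x⇒x≉0 : ∀ {x} → 0# < x → ¬ (x ≈ 0#)
  0<x⇒x≉0 0<x x≈0 = irrefl (sym x≈0) 0<x

  *-cancelʳ : ∀ {x y z} → ¬ (z ≈ 0#) → x * z ≈ y * z → x ≈ y
  *-cancelʳ {x} {y} {z} z≉0 xz≈yz = begin
    x               ≈⟨ step x ⟨
    x * z * z ⁻¹    ≈⟨ *-congʳ xz≈yz ⟩
    y * z * z ⁻¹    ≈⟨ step y ⟩
    y               ∎
    where
    step : ∀ w → w * z * z ⁻¹ ≈ w
    step w = trans (*-assoc w z (z ⁻¹))
                   (trans (*-congˡ (⁻¹-inverseʳ z z≉0)) (*-identityʳ w))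

  -- The inverse is specified only through `⁻¹-inverseʳ`, so the two sides are compared after
  -- multiplication by x * y, which is nonzero because it is positive.
  ⁻¹-distrib-* : ∀ {x y} → 0# < x → 0# < y → (x * y) ⁻¹ ≈ x ⁻¹ * y ⁻¹
  ⁻¹-distrib-* {x} {y} 0<x 0<y = *-cancelʳ xy≉0 (begin
    (x * y) ⁻¹ * (x * y)       ≈⟨ *-comm _ _ ⟩
    x * y * (x * y) ⁻¹         ≈⟨ ⁻¹-inverseʳ _ xy≉0 ⟩
    1#                         ≈⟨ *-identityʳ 1# ⟨
    1# * 1#
      ≈⟨ *-cong (⁻¹-inverseʳ x (0<x⇒x≉0 0<x)) (⁻¹-inverseʳ y (0<x⇒x≉0 0<y)) ⟨
    x * x ⁻¹ * (y * y ⁻¹)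
      ≈⟨ solve 4 (λ x u y v → x :* u :* (y :* v) := u :* v :* (x :* y)) refl x _ y _ ⟩
    x ⁻¹ * y ⁻¹ * (x * y)      ∎)
    where xy≉0 = 0<x⇒x≉0 (*-pos 0<x 0<y)

  x-0≈x : ∀ x → x - 0# ≈ x
  x-0≈x = solve 1 (λ x → x :- con (+ 0) := x) refl

-- Piecewise affine functions of one variable.

module PiecewiseAffineProperties {c ℓ₁ ℓ₂} (K : OrderedField c ℓ₁ ℓ₂) where
  open OrderedField K
  open OrderedFieldProperties K
  open CommutativeRing commutativeRing using (refl; sym; trans)
  open IsStrictTotalOrder isStrictTotalOrder
    using (<-respʳ-≈; <-respˡ-≈) renaming (trans to <-trans)
  open IntegerCoefficients commutativeRing using (module Solver)
  open Solver using (solve; _:=_; _:+_; _:*_; _:-_; :-_; con)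
  open import Relation.Binary.Reasoning.Setoid setoid

  -- The common form of the conditions in `Slope⁺` and `Slope⁻`: g is read as a function of the
  -- offset h, so that one lemma serves both directions.
  LinearUpTo : (Carrier → Carrier) → (c s ε : Carrier) → Set _
  LinearUpTo g c s ε = ∀ h → 0# ≤ h → h ≤ ε → g h ≈ c + s * h

  -- Both formulas hold at one positive offset h, where c cancels and h can be divided out. This
  -- identifies the slopes supplied by a Laplacian with those of an affine piece.
  slope-unique : ∀ {g c s s′ ε ε′} → 0# < ε → 0# < ε′ →
                 LinearUpTo g c s ε → LinearUpTo g c s′ ε′ → s ≈ s′
  slope-unique {g} {c} {s} {s′} 0<ε 0<ε′ lin lin′
    with h , 0<h , h≤ε , h≤ε′ ← positive-lower-bound 0<ε 0<ε′ =
    *-cancelʳ (0<x⇒x≉0 0<h) (begin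
      s * h               ≈⟨ step s ⟨
      c + s * h - c       ≈⟨ +-congʳ (lin h (inj₁ 0<h) h≤ε) ⟨
      g h - c             ≈⟨ +-congʳ (lin′ h (inj₁ 0<h) h≤ε′) ⟩
      c + s′ * h - c      ≈⟨ step s′ ⟩
      s′ * h              ∎)
    where
    step : ∀ s {h} → c + s * h - c ≈ s * h
    step s {h} = solve 3 (λ c s h → c :+ s :* h :- c := s :* h) refl c s h

  AffineOn : (Carrier → Carrier) → (a b s : Carrier) → Set _
  AffineOn g a b s = ∀ t → a ≤ t → t ≤ b → g t ≈ g a + s * (t - a)

  module _ {g : Carrier → Carrier} {a b s : Carrier} where

    affine-right : AffineOn g a b s → LinearUpTo (λ h → g (a + h)) (g a) s (b - a)
    affine-right aff h 0≤h h≤b-a = trans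
      (aff (a + h)
        (0≤y-x⇒x≤y (≤-trans 0≤h (inj₂ (sym a+h-a≈h))))
        (0≤y-x⇒x≤y (≤-trans (x≤y⇒0≤y-x h≤b-a)
          (inj₂ (solve 3 (λ a b h → b :- a :- h := b :- (a :+ h)) refl a b h)))))
      (+-congˡ (*-congˡ a+h-a≈h))
      where
      a+h-a≈h : a + h - a ≈ h
      a+h-a≈h = solve 2 (λ a h → a :+ h :- a := h) refl a h

    -- Offsets from b run against the parameter, whence the sign of the slope.
    affine-left : a ≤ b → AffineOn g a b s →
                  LinearUpTo (λ h → g (b - h)) (g b) (- s) (b - a)
    affine-left a≤b aff h 0≤h h≤b-a = begin
      g (b - h)
        ≈⟨ aff (b - h)
             (0≤y-x⇒x≤y (≤-trans (x≤y⇒0≤y-x h≤b-a)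
               (inj₂ (solve 3 (λ a b h → b :- a :- h := b :- h :- a) refl a b h))))
             (0≤y-x⇒x≤y (≤-trans 0≤h
               (inj₂ (solve 2 (λ b h → h := b :- (b :- h)) refl b h)))) ⟩
      g a + s * (b - h - a)
        ≈⟨ solve 5 (λ c s a b h → c :+ s :* (b :- h :- a)
                              := c :+ s :* (b :- a) :+ :- s :* h) refl (g a) s a b h ⟩
      g a + s * (b - a) + - s * h
        ≈⟨ +-congʳ (aff b a≤b ≤-refl) ⟨
      g b + - s * h ∎

  -- The slope sum at an interior point of an edge, transferred to a function of the parameter
  -- alone.
  record SlopeSum (g : Carrier → Carrier) (t σ : Carrier) : Set (c ⊔ ℓ₁ ⊔ ℓ₂) where
    field
      s⁺ s⁻ ε⁺ ε⁻ : Carrier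
      0<ε⁺ : 0# < ε⁺
      0<ε⁻ : 0# < ε⁻
      right : LinearUpTo (λ h → g (t + h)) (g t) s⁺ ε⁺
      left  : LinearUpTo (λ h → g (t - h)) (g t) s⁻ ε⁻
      total : σ ≈ s⁺ + s⁻

  -- To the right of m the outgoing slope is s′, to the left it is - s; `slope-unique` matches these
  -- with the slopes in the given sum.
  slopeSum-affine : ∀ {g a m b s s′ σ} → a < m → m < b →
                    AffineOn g a m s → AffineOn g m b s′ →
                    SlopeSum g m σ → σ ≈ s′ - s
  slopeSum-affine a<m m<b aff aff′ S = trans total
    (+-cong (slope-unique 0<ε⁺ (x<y⇒0<y-x m<b) right (affine-right aff′))
            (slope-unique 0<ε⁻ (x<y⇒0<y-x a<m) left (affine-left (inj₁ a<m) aff)))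
    where open SlopeSum S

  affine-glue : ∀ {g a m b s s′} → a ≤ m → s ≈ s′ →
                AffineOn g a m s → AffineOn g m b s′ → AffineOn g a b s
  affine-glue {g} {a} {m} {b} {s} {s′} a≤m s≈s′ aff aff′ t a≤t t≤b with compare t m
  ... | tri< t<m _ _ = aff t a≤t (inj₁ t<m)
  ... | tri≈ _ t≈m _ = aff t a≤t (inj₂ t≈m)
  ... | tri> _ _ m<t = begin
    g t                                 ≈⟨ aff′ t (inj₁ m<t) t≤b ⟩
    g m + s′ * (t - m)                  ≈⟨ +-cong (aff m a≤m ≤-refl) (*-congʳ (sym s≈s′)) ⟩
    g a + s * (m - a) + s * (t - m)
      ≈⟨ solve 5 (λ c s a m t → c :+ s :* (m :- a) :+ s :* (t :- m)
                             := c :+ s :* (t :- a)) refl (g a) s a m t ⟩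
    g a + s * (t - a)                   ∎

  -- Induction on the pieces: both halves are affine, and the vanishing slope sum at the break point
  -- m forces their slopes to agree.
  harmonic⇒affine : ∀ {g a b} → PiecewiseAffineOn K g a b →
                    (∀ t → a < t → t < b → SlopeSum g t 0#) → ∃[ s ] AffineOn g a b s
  harmonic⇒affine (affine s aff) _ = s , aff
  harmonic⇒affine {g} (join m a<m m<b l r) bal
    with s , aff ← harmonic⇒affine l (λ t a<t t<m → bal t a<t (<-trans t<m m<b))
       | s′ , aff′ ← harmonic⇒affine r (λ t m<t t<b → bal t (<-trans a<m m<t) t<b) =
    s , affine-glue (inj₁ a<m) s≈s′ aff aff′
    where
    s≈s′ : s ≈ s′
    s≈s′ = begin
      s              ≈⟨ +-identityʳ s ⟨
      s + 0#         ≈⟨ +-congˡ (slopeSum-affine a<m m<b aff aff′ (bal m a<m m<b)) ⟩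
      s + (s′ - s)   ≈⟨ solve 2 (λ s s′ → s :+ (s′ :- s) := s′) refl s s′ ⟩
      s′             ∎

  module _ {g : Carrier → Carrier} (g-cong : ∀ {s t} → s ≈ t → g s ≈ g t) where

    -- Equality in the field is a setoid relation, so an interval whose end point `compare` finds
    -- equal to x still has to be transported to x.
    piecewiseAffine-resp : ∀ {a a′ b b′} → a ≈ a′ → b ≈ b′ →
                           PiecewiseAffineOn K g a b → PiecewiseAffineOn K g a′ b′
    piecewiseAffine-resp a≈a′ b≈b′ (affine s aff) = affine s λ t a′≤t t≤b′ → trans
      (aff t (≤-trans (inj₂ a≈a′) a′≤t) (≤-trans t≤b′ (inj₂ (sym b≈b′))))
      (+-cong (g-cong a≈a′) (*-congˡ (+-congˡ (-‿cong a≈a′))))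
    piecewiseAffine-resp a≈a′ b≈b′ (join m a<m m<b l r) =
      join m (<-respˡ-≈ a≈a′ a<m) (<-respʳ-≈ b≈b′ m<b)
        (piecewiseAffine-resp a≈a′ refl l) (piecewiseAffine-resp refl b≈b′ r)

    -- A source or sink need not be among the given break points of its edge. Cutting there lets
    -- `harmonic⇒affine` apply on either side.
    piecewiseAffine-split : ∀ {a b x} → a < x → x < b → PiecewiseAffineOn K g a b →
                            PiecewiseAffineOn K g a x × PiecewiseAffineOn K g x b
    piecewiseAffine-split {a} {b} {x} a<x x<b (affine s aff) =
      affine s (λ t a≤t t≤x → aff t a≤t (≤-trans t≤x (inj₁ x<b))) ,
      affine s λ t x≤t t≤b → begin
        g t                                 ≈⟨ aff t (≤-trans (inj₁ a<x) x≤t) t≤b ⟩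
        g a + s * (t - a)
          ≈⟨ solve 5 (λ c s a x t → c :+ s :* (t :- a)
                                 := c :+ s :* (x :- a) :+ s :* (t :- x)) refl (g a) s a x t ⟩
        g a + s * (x - a) + s * (t - x)     ≈⟨ +-congʳ (aff x (inj₁ a<x) (inj₁ x<b)) ⟨
        g x + s * (t - x)                   ∎
    piecewiseAffine-split {x = x} a<x x<b (join m a<m m<b l r) with compare x m
    ... | tri≈ _ x≈m _ = piecewiseAffine-resp refl (sym x≈m) l ,
                         piecewiseAffine-resp (sym x≈m) refl r
    ... | tri< x<m _ _ with l₁ , l₂ ← piecewiseAffine-split a<x x<m l =
      l₁ , join m x<m m<b l₂ r
    ... | tri> _ _ m<x with r₁ , r₂ ← piecewiseAffine-split m<x x<b r =
      join m a<m m<x l r₁ , r₂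

module CircuitProperties {c ℓ₁ ℓ₂} {K : OrderedField c ℓ₁ ℓ₂} (Γ : MetrizedGraph K) where
  open OrderedField K hiding (zero)
  open MetrizedGraph Γ
  open Circuit Γ
  open OrderedFieldProperties K
  open PiecewiseAffineProperties K
  open CommutativeRing commutativeRing using (refl; sym; trans; reflexive)
  open IsStrictTotalOrder isStrictTotalOrder
    using (irrefl) renaming (trans to <-trans)
  open IntegerCoefficients commutativeRing using (module Solver)
  open Solver using (solve; _:=_; _:+_; _:*_; _:-_; :-_; con)
  open import Algebra.Properties.Semiring.Sum semiring
    using (sum-cong-≋; sum-replicate-zero; ∑-distrib-+; ∑-comm; *-distribˡ-sum)
  open import Algebra.Properties.Ring ring using (-0#≈0#)
  open import Relation.Binary.Reasoning.Setoid setoid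

  -- Points of an edge and their parameters.

  vertex-reflexive : ∀ {P v} → P ≡ vertex v → P ≈ₚ vertex v
  vertex-reflexive ≡.refl = vertex ≡.refl

  at-p : ∀ {e t} → t ≤ 0# → at e t ≡ vertex (p e)
  at-p {e} {t} t≤0 with compare 0# t | compare t (L e)
  ... | tri< 0<t _ _ | _ = contradiction 0<t (≤⇒≯ t≤0)
  ... | tri≈ _ _ _   | _ = ≡.refl
  ... | tri> _ _ _   | _ = ≡.refl

  at-q : ∀ {e t} → L e ≤ t → at e t ≡ vertex (q e)
  at-q {e} {t} L≤t with compare 0# t | compare t (L e)
  ... | tri< _ _ _   | tri< t<L _ _ = contradiction t<L (≤⇒≯ L≤t)
  ... | tri< _ _ _   | tri≈ _ _ _   = ≡.refl
  ... | tri< _ _ _   | tri> _ _ _   = ≡.refl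
  ... | tri≈ 0≮t _ _ | _            = contradiction (<-≤-trans (L>0 e) L≤t) 0≮t
  ... | tri> 0≮t _ _ | _            = contradiction (<-≤-trans (L>0 e) L≤t) 0≮t

  -- Equality of points compares edges and parameters, so the bounds that `compare` produces inside
  -- `at` may differ from the given ones.
  at-interior : ∀ {e s t 0<t t<L} → s ≈ t → at e s ≈ₚ interior e t 0<t t<L
  at-interior {e} {s} {t} {0<t} {t<L} s≈t with compare 0# s | compare s (L e)
  ... | tri< _ _ _   | tri< _ _ _   = interior ≡.refl s≈t
  ... | tri< _ _ _   | tri≈ s≮L _ _ = contradiction (≤-<-trans (inj₂ s≈t) t<L) s≮L
  ... | tri< _ _ _   | tri> s≮L _ _ = contradiction (≤-<-trans (inj₂ s≈t) t<L) s≮L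
  ... | tri≈ 0≮s _ _ | _ = contradiction (<-≤-trans 0<t (inj₂ (sym s≈t))) 0≮s
  ... | tri> 0≮s _ _ | _ = contradiction (<-≤-trans 0<t (inj₂ (sym s≈t))) 0≮s

  at-cong : ∀ {e s t} → s ≈ t → at e s ≈ₚ at e t
  at-cong {e} {s} {t} s≈t with compare 0# t | compare t (L e)
  ... | tri< 0<t _ _ | tri< t<L _ _ = at-interior s≈t
  ... | tri< _ _ _   | tri≈ _ t≈L _ = vertex-reflexive (at-q (inj₂ (sym (trans s≈t t≈L))))
  ... | tri< _ _ _   | tri> _ _ L<t =
    vertex-reflexive (at-q (inj₁ (<-≤-trans L<t (inj₂ (sym s≈t)))))
  ... | tri≈ _ 0≈t _ | _ = vertex-reflexive (at-p (inj₂ (trans s≈t (sym 0≈t))))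
  ... | tri> _ _ t<0 | _ = vertex-reflexive (at-p (inj₁ (≤-<-trans (inj₂ s≈t) t<0)))

  -- Vertex functions and their affine interpolation.

  rise : (Vertex → Carrier) → Edge → Carrier
  rise φ e = φ (q e) - φ (p e)

  -- The function φ̃ of the overview.
  interpolate : (Vertex → Carrier) → Point → Carrier
  interpolate φ (vertex v)         = φ v
  interpolate φ (interior e t _ _) = φ (p e) + t / L e * rise φ e

  L*L⁻¹≈1 : ∀ e → L e * L e ⁻¹ ≈ 1#
  L*L⁻¹≈1 e = ⁻¹-inverseʳ (L e) (0<x⇒x≉0 (L>0 e))

  -- At the two ends `at` yields a vertex, and the formula persists there because t / L e becomes 0
  -- or 1.
  interpolate-at : ∀ φ e {t} → 0# ≤ t → t ≤ L e →
                   interpolate φ (at e t) ≈ φ (p e) + t / L e * rise φ e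
  interpolate-at φ e {t} 0≤t t≤L with compare 0# t | compare t (L e)
  ... | tri< _ _ _   | tri< _ _ _   = refl
  ... | tri< _ _ _   | tri≈ _ t≈L _ = sym (begin
    φ (p e) + t / L e * rise φ e   ≈⟨ +-congˡ (*-congʳ (trans (*-congʳ t≈L) (L*L⁻¹≈1 e))) ⟩
    φ (p e) + 1# * rise φ e
      ≈⟨ solve 2 (λ x y → x :+ con (+ 1) :* (y :- x) := y) refl (φ (p e)) (φ (q e)) ⟩
    φ (q e)                        ∎)
  ... | tri< _ _ _   | tri> _ _ L<t = contradiction L<t (≤⇒≯ t≤L)
  ... | tri≈ _ 0≈t _ | _            = sym (begin
    φ (p e) + t / L e * rise φ e   ≈⟨ +-congˡ (*-congʳ (*-congʳ 0≈t)) ⟨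
    φ (p e) + 0# / L e * rise φ e
      ≈⟨ solve 3 (λ x l d → x :+ con (+ 0) :* l :* d := x) refl (φ (p e)) (L e ⁻¹) (rise φ e) ⟩
    φ (p e)                        ∎)
  ... | tri> _ _ t<0 | _            = contradiction t<0 (≤⇒≯ 0≤t)

  -- The value at P of the Green function of the edge containing P, with both
  -- end points grounded and pole P.
  bump : Point → Carrier
  bump (vertex _)         = 0#
  bump (interior e t _ _) = t * (L e - t) / L e

  bump-at : ∀ e {t} → 0# ≤ t → t ≤ L e → bump (at e t) ≈ t * (L e - t) / L e
  bump-at e {t} 0≤t t≤L with compare 0# t | compare t (L e)
  ... | tri< _ _ _   | tri< _ _ _   = refl
  ... | tri< _ _ _   | tri≈ _ t≈L _ = sym (begin
    t * (L e - t) / L e    ≈⟨ *-congʳ (*-congˡ (+-congʳ t≈L)) ⟨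
    t * (t - t) / L e
      ≈⟨ solve 2 (λ t l → t :* (t :- t) :* l := con (+ 0)) refl t (L e ⁻¹) ⟩
    0#                     ∎)
  ... | tri< _ _ _   | tri> _ _ L<t = contradiction L<t (≤⇒≯ t≤L)
  ... | tri≈ _ 0≈t _ | _            = sym (begin
    t * (L e - t) / L e    ≈⟨ *-congʳ (*-congʳ 0≈t) ⟨
    0# * (L e - t) / L e
      ≈⟨ solve 2 (λ x l → con (+ 0) :* x :* l := con (+ 0)) refl (L e - t) (L e ⁻¹) ⟩
    0#                     ∎)
  ... | tri> _ _ t<0 | _            = contradiction t<0 (≤⇒≯ 0≤t)

  -- Slopes of a function along one edge.

  -- Restricted to e, the Laplacian of f has mass κ at the parameter t and is
  -- zero at all other interior points; A and B are the slopes at the two end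
  -- points, in the directions pointing into e.
  record EdgeSlopes (f : Point → Carrier) (e : Edge) (t κ : Carrier) :
                    Set (c ⊔ ℓ₁ ⊔ ℓ₂) where
    field
      A B εᴬ εᴮ : Carrier
      0<εᴬ  : 0# < εᴬ
      0<εᴮ  : 0# < εᴮ
      right : LinearUpTo (λ h → f (at e (0# + h))) (f (at e 0#)) A εᴬ
      left  : LinearUpTo (λ h → f (at e (L e - h))) (f (at e (L e))) B εᴮ
      A+B≈κ : A + B ≈ κ
      AL≈   : A * L e ≈ rise (f ∘ vertex) e + κ * (L e - t)
      value : f (at e t) ≈ f (vertex (p e)) + A * t

    A≈ : A ≈ (rise (f ∘ vertex) e + κ * (L e - t)) / L e
    A≈ = begin
      A                    ≈⟨ *-identityʳ A ⟨
      A * 1#               ≈⟨ *-congˡ (L*L⁻¹≈1 e) ⟨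
      A * (L e / L e)      ≈⟨ *-assoc A _ _ ⟨
      A * L e / L e        ≈⟨ *-congʳ AL≈ ⟩
      (rise (f ∘ vertex) e + κ * (L e - t)) / L e ∎

    -- Eliminating B by A + B = κ and A by `A≈` gives the share of one edge in the summation by
    -- parts of `dirichlet-voltage`.
    green : ∀ φ → φ (p e) * A + φ (q e) * B ≈
            κ * (φ (p e) + t / L e * rise φ e) - rise φ e * (rise (f ∘ vertex) e / L e)
    green φ = begin
      x * A + y * B
        ≈⟨ solve 4 (λ x y a b → x :* a :+ y :* b := (a :+ b) :* y :- a :* (y :- x)) refl x y A B ⟩
      (A + B) * y - A * (y - x)
        ≈⟨ +-cong (*-congʳ A+B≈κ) (-‿cong (*-congʳ A≈)) ⟩
      κ * y - (d + κ * (L e - t)) / L e * (y - x)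
        -- To the solver the inverse is an independent variable, so `L e / L e` is isolated here and
        -- replaced by 1 in the next step.
        ≈⟨ solve 7 (λ x y d k t l i →
             k :* y :- (d :+ k :* (l :- t)) :* i :* (y :- x)
               := k :* (y :- l :* i :* (y :- x) :+ t :* i :* (y :- x)) :- (y :- x) :* (d :* i))
             refl x y d κ t (L e) (L e ⁻¹) ⟩
      κ * (y - L e / L e * (y - x) + t / L e * (y - x)) - (y - x) * (d / L e)
        ≈⟨ +-congʳ (*-congˡ (+-congʳ (+-congˡ (-‿cong (*-congʳ (L*L⁻¹≈1 e)))))) ⟩
      κ * (y - 1# * (y - x) + t / L e * (y - x)) - (y - x) * (d / L e)
        ≈⟨ solve 6 (λ x y d k w i →
             k :* (y :- con (+ 1) :* (y :- x) :+ w :* (y :- x)) :- (y :- x) :* (d :* i)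
               := k :* (x :+ w :* (y :- x)) :- (y :- x) :* (d :* i))
             refl x y d κ (t / L e) (L e ⁻¹) ⟩
      κ * (x + t / L e * (y - x)) - (y - x) * (d / L e)
      ∎
      where
      x = φ (p e)
      y = φ (q e)
      d = rise (f ∘ vertex) e

    -- Inserting `A≈` into `value` separates the affine interpolation at t from κ times the grounded
    -- Green function of the edge.
    evaluate : f (at e t) ≈ f (vertex (p e)) + t / L e * rise (f ∘ vertex) e
                            + κ * (t * (L e - t) / L e)
    evaluate = trans value (trans (+-congˡ (*-congʳ A≈))
      (solve 6 (λ x d k t l i → x :+ (d :+ k :* (l :- t)) :* i :* t
                             := x :+ t :* i :* d :+ k :* (t :* (l :- t) :* i))
        refl (f (vertex (p e))) (rise (f ∘ vertex) e) κ t (L e) (L e ⁻¹)))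

  module _ {f μ : Point → Carrier} (F : ContinuousPiecewiseAffine f)
           (Δf : HasLaplacian f μ) (e : Edge) where
    open ContinuousPiecewiseAffine F renaming (cong to f-cong)

    private
      g : Carrier → Carrier
      g t = f (at e t)

      g-cong : ∀ {s t} → s ≈ t → g s ≈ g t
      g-cong s≈t = f-cong (at-cong s≈t)

      g0≈ : g 0# ≈ f (vertex (p e))
      g0≈ = reflexive (≡.cong f (at-p ≤-refl))

      gL≈ : g (L e) ≈ f (vertex (q e))
      gL≈ = reflexive (≡.cong f (at-q ≤-refl))

      0<L-0 : 0# < L e - 0#
      0<L-0 = x<y⇒0<y-x (L>0 e)

    slopeSum : ∀ {t σ} 0<t t<L → - μ (interior e t 0<t t<L) ≈ σ → SlopeSum g t σ
    slopeSum 0<t t<L -μ≈σ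
      with s⁺ , s⁻ , (ε⁺ , 0<ε⁺ , _ , lin⁺) , (ε⁻ , 0<ε⁻ , _ , lin⁻) , σ≈
        ← Δf (interior e _ 0<t t<L) = record
      { 0<ε⁺ = 0<ε⁺ ; 0<ε⁻ = 0<ε⁻ ; right = lin⁺ ; left = lin⁻
      ; total = trans (sym -μ≈σ) σ≈ }

    slopeSum-zero : ∀ {t} 0<t t<L → μ (interior e t 0<t t<L) ≈ 0# → SlopeSum g t 0#
    slopeSum-zero 0<t t<L μ≈0 = slopeSum 0<t t<L (trans (-‿cong μ≈0) -0#≈0#)

    -- The function is affine on the whole edge. With κ = 0 there is no kink, and t = 0 serves as a
    -- default parameter.
    edgeSlopes-harmonic :
      (∀ t 0<t t<L → μ (interior e t 0<t t<L) ≈ 0#) → EdgeSlopes f e 0# 0#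
    edgeSlopes-harmonic bal
      with s , aff ← harmonic⇒affine (piecewiseAffine e)
                       (λ t 0<t t<L → slopeSum-zero 0<t t<L (bal t 0<t t<L)) = record
      { A = s ; B = - s ; 0<εᴬ = 0<L-0 ; 0<εᴮ = 0<L-0
      ; right = affine-right aff
      ; left  = affine-left (inj₁ (L>0 e)) aff
      ; A+B≈κ = -‿inverseʳ s
      ; AL≈   = begin
          s * L e
            ≈⟨ solve 3 (λ s l a →
                 s :* l := a :+ s :* (l :- con (+ 0)) :- a :+ con (+ 0) :* (l :- con (+ 0)))
                 refl s (L e) (g 0#) ⟩
          g 0# + s * (L e - 0#) - g 0# + 0# * (L e - 0#)
            ≈⟨ +-congʳ (+-cong (trans (sym (aff (L e) (inj₁ (L>0 e)) ≤-refl)) gL≈) (-‿cong g0≈)) ⟩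
          f (vertex (q e)) - f (vertex (p e)) + 0# * (L e - 0#) ∎
      ; value = trans g0≈ (sym (trans (+-congˡ (zeroʳ s)) (+-identityʳ _)))
      }

    -- The edge is cut at t. The Laplacian vanishes inside both pieces, so each is affine, and κ is
    -- the drop of the slope across t.
    edgeSlopes-kink : ∀ {t 0<t t<L κ} →
      μ (interior e t 0<t t<L) ≈ κ →
      (∀ s 0<s s<L → ¬ (s ≈ t) → μ (interior e s 0<s s<L) ≈ 0#) →
      EdgeSlopes f e t κ
    edgeSlopes-kink {t} {0<t} {t<L} {κ} kink bal
      with l , r ← piecewiseAffine-split g-cong 0<t t<L (piecewiseAffine e)
      with s , aff ← harmonic⇒affine l
             (λ u 0<u u<t → let u<L = <-trans u<t t<L in
               slopeSum-zero 0<u u<L (bal u 0<u u<L (λ u≈t → irrefl u≈t u<t)))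
         | s′ , aff′ ← harmonic⇒affine r
             (λ u t<u u<L → let 0<u = <-trans 0<t t<u in
               slopeSum-zero 0<u u<L (bal u 0<u u<L (λ u≈t → irrefl (sym u≈t) t<u))) = record
      { A = s ; B = - s′ ; 0<εᴬ = x<y⇒0<y-x 0<t ; 0<εᴮ = x<y⇒0<y-x t<L
      ; right = affine-right aff
      ; left  = affine-left (inj₁ t<L) aff′
      ; A+B≈κ = sym κ≈
      -- The slope is s up to t and s′ = s - κ beyond, so the rise along e is s * L e - κ * (L e -
      -- t).
      ; AL≈   = begin
          s * L e
            ≈⟨ solve 5 (λ s s′ l t a →
                 s :* l := a :+ s :* (t :- con (+ 0)) :+ s′ :* (l :- t) :- a
                           :+ (s :- s′) :* (l :- t))
                 refl s s′ (L e) t (g 0#) ⟩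
          g 0# + s * (t - 0#) + s′ * (L e - t) - g 0# + (s - s′) * (L e - t)
            ≈⟨ +-congʳ (+-congʳ (+-congʳ (aff t (inj₁ 0<t) ≤-refl))) ⟨
          g t + s′ * (L e - t) - g 0# + (s - s′) * (L e - t)
            ≈⟨ +-cong (+-cong (trans (sym (aff′ (L e) (inj₁ t<L) ≤-refl)) gL≈) (-‿cong g0≈))
                      (*-congʳ (sym κ≈)) ⟩
          f (vertex (q e)) - f (vertex (p e)) + κ * (L e - t) ∎
      ; value = trans (aff t (inj₁ 0<t) ≤-refl) (+-cong g0≈ (*-congˡ (x-0≈x t)))
      }
      where
      κ≈ : κ ≈ s - s′
      κ≈ = begin
        κ           ≈⟨ solve 1 (λ k → k := :- (:- k)) refl κ ⟩
        - - κ       ≈⟨ -‿cong (slopeSum-affine 0<t t<L aff aff′ (slopeSum 0<t t<L (-‿cong kink))) ⟩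
        - (s′ - s)  ≈⟨ solve 2 (λ s s′ → :- (s′ :- s) := s :- s′) refl s s′ ⟩
        s - s′      ∎

  -- Finite sums over vertices and edges.

  if-cong : ∀ {a} {A : Set a} (d : Dec A) {x y : Carrier} → (A → x ≈ y) →
            (if does d then x else 0#) ≈ (if does d then y else 0#)
  if-cong (yes a) x≈y = x≈y a
  if-cong (no _)  _   = refl

  if-*ˡ : ∀ {a} {A : Set a} (d : Dec A) {x y} →
          x * (if does d then y else 0#) ≈ (if does d then x * y else 0#)
  if-*ˡ (yes _) = refl
  if-*ˡ (no _)  = zeroʳ _

  sum-distrib-minus : ∀ {n} (f g : Fin n → Carrier) →
                  sum (λ i → f i - g i) ≈ sum f - sum g
  sum-distrib-minus {zero}  f g = sym (-‿inverseʳ 0#)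
  sum-distrib-minus {suc n} f g = trans (+-congˡ (sum-distrib-minus (f ∘ suc) (g ∘ suc)))
    (solve 4 (λ a b s t → a :- b :+ (s :- t) := a :+ s :- (b :+ t)) refl
      (f zero) (g zero) (sum (f ∘ suc)) (sum (g ∘ suc)))

  sum-select : ∀ {n} (u : Fin n) (φ : Fin n → Carrier) →
               sum (λ v → if does (u Fin.≟ v) then φ v else 0#) ≈ φ u
  sum-select {suc n} zero    φ = trans (+-congˡ (sum-replicate-zero n)) (+-identityʳ _)
  sum-select         (suc u) φ = trans (+-identityˡ _) (sum-select u (φ ∘ suc))

  -- After exchanging the sums, e contributes only at v = π e. With π = p and π = q in turn, a
  -- self-loop is counted once for each of its ends.
  sum-fibre : ∀ {m n} (π : Fin m → Fin n) (φ : Fin n → Carrier) (a : Fin m → Carrier) →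
              sum (λ v → φ v * sum (λ e → if does (π e Fin.≟ v) then a e else 0#)) ≈
              sum (λ e → φ (π e) * a e)
  sum-fibre {m} {n} π φ a = begin
    sum (λ v → φ v * sum (λ e → if does (π e Fin.≟ v) then a e else 0#))
      ≈⟨ sum-cong-≋ {n} (λ v → *-distribˡ-sum {m} (φ v) _) ⟩
    sum (λ v → sum (λ e → φ v * (if does (π e Fin.≟ v) then a e else 0#)))
      ≈⟨ ∑-comm {n} {m} _ ⟩
    sum (λ e → sum (λ v → φ v * (if does (π e Fin.≟ v) then a e else 0#)))
      ≈⟨ sum-cong-≋ {m} (λ e → trans (sum-cong-≋ {n} (λ v → if-*ˡ (π e Fin.≟ v)))
                                      (sum-select (π e) (λ v → φ v * a e))) ⟩
    sum (λ e → φ (π e) * a e) ∎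

  -- Point masses at vertices and inside edges.

  data InteriorTo (e : Edge) : Point → Set (c ⊔ ℓ₂) where
    inside : ∀ {t 0<t t<L} → InteriorTo e (interior e t 0<t t<L)

  interiorTo? : ∀ e P → Dec (InteriorTo e P)
  interiorTo? e (vertex _) = no λ ()
  interiorTo? e (interior e′ _ _ _) with e Fin.≟ e′
  ... | yes ≡.refl = yes inside
  ... | no  e≢e′   = no λ { inside → e≢e′ ≡.refl }

  -- The part of δ_P carried by the open edge e.
  mass : Point → Edge → Carrier
  mass (vertex _)          e = 0#
  mass (interior e′ _ _ _) e = if does (e′ Fin.≟ e) then 1# else 0#

  mass-inside : ∀ {e P} → InteriorTo e P → mass P e ≈ 1#
  mass-inside {e} inside with e Fin.≟ e
  ... | yes _   = refl
  ... | no  e≢e = contradiction ≡.refl e≢e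

  mass-outside : ∀ {e P} → ¬ InteriorTo e P → mass P e ≈ 0#
  mass-outside {e} {vertex _}          _ = refl
  mass-outside {e} {interior e′ _ _ _} ∉ with e′ Fin.≟ e
  ... | yes ≡.refl = contradiction inside ∉
  ... | no  _      = refl

  δ-≈ : ∀ P Q → P ≈ₚ Q → δ Q P ≈ 1#
  δ-≈ P Q P≈Q with P ≟ₚ Q
  ... | yes _  = refl
  ... | no P≉Q = contradiction P≈Q P≉Q

  δ-≉ : ∀ P Q → ¬ (P ≈ₚ Q) → δ Q P ≈ 0#
  δ-≉ P Q P≉Q with P ≟ₚ Q
  ... | yes P≈Q = contradiction P≈Q P≉Q
  ... | no _    = refl

  δ-vertex : ∀ u v → δ (vertex u) (vertex v) ≈ (if does (u Fin.≟ v) then 1# else 0#)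
  δ-vertex u v with u Fin.≟ v
  ... | yes u≡v = δ-≈ (vertex v) (vertex u) (vertex (≡.sym u≡v))
  ... | no  u≢v = δ-≉ (vertex v) (vertex u) λ { (vertex v≡u) → u≢v (≡.sym v≡u) }

  δ-outside : ∀ e s 0<s s<L P → ¬ InteriorTo e P → δ P (interior e s 0<s s<L) ≈ 0#
  δ-outside e s 0<s s<L P ∉ = δ-≉ (interior e s 0<s s<L) P λ { (interior ≡.refl _) → ∉ inside }

  -- A test function is integrated against δ_P through its values at the
  -- vertices if P is a vertex, and through the edge containing P otherwise.
  interpolate-split : ∀ φ P →
    sum (λ v → φ v * δ P (vertex v)) + sum (λ e → mass P e * interpolate φ P) ≈
    interpolate φ P
  interpolate-split φ (vertex u) = begin
    sum (λ v → φ v * δ (vertex u) (vertex v)) + sum {#edges} (λ e → 0# * φ u)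
      ≈⟨ +-cong
           (trans (sum-cong-≋ {#vertices} λ v → trans (*-congˡ (δ-vertex u v)) (if-*ˡ (u Fin.≟ v)))
                  (trans (sum-select u (λ v → φ v * 1#)) (*-identityʳ _)))
           (trans (sum-cong-≋ {#edges} λ _ → zeroˡ (φ u)) (sum-replicate-zero #edges)) ⟩
    φ u + 0#   ≈⟨ +-identityʳ _ ⟩
    φ u        ∎
  interpolate-split φ P@(interior e′ _ _ _) = begin
    sum (λ v → φ v * 0#) + sum (λ e → mass P e * interpolate φ P)
      ≈⟨ +-cong
           (trans (sum-cong-≋ {#vertices} λ v → zeroʳ (φ v)) (sum-replicate-zero #vertices))
           (trans (sum-cong-≋ {#edges} λ e → trans (*-comm _ _) (if-*ˡ (e′ Fin.≟ e)))
                  (trans (sum-select e′ (λ _ → interpolate φ P * 1#)) (*-identityʳ _))) ⟩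
    0# + interpolate φ P   ≈⟨ +-identityˡ _ ⟩
    interpolate φ P        ∎

  -- Energy form, summation by parts and reciprocity.

  -- Each edge then has at most one kink, as `EdgeSlopes` provides for. A vertex is apart from every
  -- point, itself included.
  Apart : Point → Point → Set _
  Apart P Q = ∀ e → InteriorTo e P → ¬ InteriorTo e Q

  -- The energy form: the integral over Γ of the product of the derivatives of the two affine
  -- extensions.
  dirichlet : (φ ψ : Vertex → Carrier) → Carrier
  dirichlet φ ψ = sum (λ e → rise φ e * (rise ψ e / L e))

  dirichlet-sym : ∀ φ ψ → dirichlet φ ψ ≈ dirichlet ψ φ
  dirichlet-sym φ ψ = sum-cong-≋ {#edges} λ e →
    solve 3 (λ x y l → x :* (y :* l) := y :* (x :* l)) refl (rise φ e) (rise ψ e) (L e ⁻¹)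

  module _ {j : Point → Point → Point → Carrier} (V : IsVoltageFunction j) where
    open IsVoltageFunction V

    private
      atVertices : Point → Point → Vertex → Carrier
      atVertices z y v = j z (vertex v) y

    edgeSlopes-source : ∀ {e t 0<t t<L z} → ¬ InteriorTo e z →
      EdgeSlopes (λ x → j z x (interior e t 0<t t<L)) e t 1#
    edgeSlopes-source {e} {t} {0<t} {t<L} {z} ∉z =
      edgeSlopes-kink (continuousPiecewiseAffine z y) (laplacian z y) e {0<t = 0<t} {t<L}
        (trans (+-cong (δ-≈ y y (interior ≡.refl refl)) (-‿cong (δ-outside e t 0<t t<L z ∉z)))
               (x-0≈x 1#))
        (λ s 0<s s<L s≉t → trans
          (+-cong (δ-≉ (interior e s 0<s s<L) y λ { (interior _ s≈t) → s≉t s≈t })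
                  (-‿cong (δ-outside e s 0<s s<L z ∉z)))
          (x-0≈x 0#))
      where y = interior e t 0<t t<L

    edgeSlopes-sink : ∀ {e t 0<t t<L y} → ¬ InteriorTo e y →
      EdgeSlopes (λ x → j (interior e t 0<t t<L) x y) e t (- 1#)
    edgeSlopes-sink {e} {t} {0<t} {t<L} {y} ∉y =
      edgeSlopes-kink (continuousPiecewiseAffine z y) (laplacian z y) e {0<t = 0<t} {t<L}
        (trans (+-cong (δ-outside e t 0<t t<L y ∉y) (-‿cong (δ-≈ z z (interior ≡.refl refl))))
               (+-identityˡ _))
        (λ s 0<s s<L s≉t → trans
          (+-cong (δ-outside e s 0<s s<L y ∉y)
                  (-‿cong (δ-≉ (interior e s 0<s s<L) z λ { (interior _ s≈t) → s≉t s≈t })))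
          (x-0≈x 0#))
      where z = interior e t 0<t t<L

    edgeSlopes-sourceless : ∀ {e y z} → ¬ InteriorTo e y → ¬ InteriorTo e z →
      EdgeSlopes (λ x → j z x y) e 0# 0#
    edgeSlopes-sourceless {e} {y} {z} ∉y ∉z =
      edgeSlopes-harmonic (continuousPiecewiseAffine z y) (laplacian z y) e λ t 0<t t<L →
        trans (+-cong (δ-outside e t 0<t t<L y ∉y) (-‿cong (δ-outside e t 0<t t<L z ∉z)))
              (x-0≈x 0#)

    -- The edge contains the source, the sink or neither. The last component rewrites κ times φ̃ at
    -- the kink through `mass`, a form that can be summed over all edges.
    edgeSlopes : ∀ {y z} → Apart y z → ∀ e →
      Σ[ t ∈ Carrier ] Σ[ κ ∈ Carrier ] (EdgeSlopes (λ x → j z x y) e t κ ×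
        (∀ φ → κ * (φ (p e) + t / L e * rise φ e) ≈
               mass y e * interpolate φ y - mass z e * interpolate φ z))
    edgeSlopes {y} {z} y∥z e with interiorTo? e y | interiorTo? e z
    ... | yes inside | yes ∈z = contradiction ∈z (y∥z e inside)
    ... | yes i@inside | no ∉z = _ , _ , edgeSlopes-source ∉z , λ φ → sym (begin
      mass y e * interpolate φ y - mass z e * interpolate φ z
        ≈⟨ +-cong (*-congʳ (mass-inside i)) (-‿cong (*-congʳ (mass-outside ∉z))) ⟩
      1# * interpolate φ y - 0# * interpolate φ z
        ≈⟨ solve 2 (λ a b → con (+ 1) :* a :- con (+ 0) :* b := con (+ 1) :* a) refl
             (interpolate φ y) (interpolate φ z) ⟩
      1# * interpolate φ y ∎)
    ... | no ∉y | yes i@inside = _ , _ , edgeSlopes-sink ∉y , λ φ → sym (begin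
      mass y e * interpolate φ y - mass z e * interpolate φ z
        ≈⟨ +-cong (*-congʳ (mass-outside ∉y)) (-‿cong (*-congʳ (mass-inside i))) ⟩
      0# * interpolate φ y - 1# * interpolate φ z
        ≈⟨ solve 2 (λ a b → con (+ 0) :* a :- con (+ 1) :* b := :- con (+ 1) :* b) refl
             (interpolate φ y) (interpolate φ z) ⟩
      - 1# * interpolate φ z ∎)
    ... | no ∉y | no ∉z = _ , _ , edgeSlopes-sourceless ∉y ∉z , λ φ → trans (zeroˡ _) (sym (begin
      mass y e * interpolate φ y - mass z e * interpolate φ z
        ≈⟨ +-cong (*-congʳ (mass-outside ∉y)) (-‿cong (*-congʳ (mass-outside ∉z))) ⟩
      0# * interpolate φ y - 0# * interpolate φ z
        ≈⟨ solve 2 (λ a b → con (+ 0) :* a :- con (+ 0) :* b := con (+ 0)) refl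
             (interpolate φ y) (interpolate φ z) ⟩
      0# ∎))

    -- The end-point terms φ(p e) A + φ(q e) B are summed in two ways: by edges through `green`, and
    -- by vertices through the Laplacian. `interpolate-split` then joins vertex and edge masses.
    dirichlet-voltage : ∀ {y z} → Apart y z → ∀ φ →
      dirichlet φ (atVertices z y) ≈ interpolate φ y - interpolate φ z
    dirichlet-voltage {y} {z} y∥z φ = begin
      E
        ≈⟨ solve 3 (λ E m n → E := m :- n :- (m :- n :- E)) refl E My Mz ⟩
      My - Mz - (My - Mz - E)
        ≈⟨ +-congˡ (-‿cong edges≈vertices) ⟩
      My - Mz - (Sz - Sy)
        ≈⟨ solve 4 (λ a b m n → m :- n :- (b :- a) := a :+ m :- (b :+ n)) refl Sy Sz My Mz ⟩
      Sy + My - (Sz + Mz)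
        ≈⟨ +-cong (interpolate-split φ y) (-‿cong (interpolate-split φ z)) ⟩
      Y - Z ∎
      where
      E = dirichlet φ (atVertices z y)
      Y = interpolate φ y
      Z = interpolate φ z
      Sy = sum (λ v → φ v * δ y (vertex v))
      Sz = sum (λ v → φ v * δ z (vertex v))
      My = sum (λ e → mass y e * Y)
      Mz = sum (λ e → mass z e * Z)

      slopes : ∀ e → EdgeSlopes (λ x → j z x y) e _ _
      slopes e = proj₁ (proj₂ (proj₂ (edgeSlopes y∥z e)))
      module S e = EdgeSlopes (slopes e)

      slopeSum-vertex : ∀ v → - (δ y (vertex v) - δ z (vertex v)) ≈
        sum (λ e → if does (p e Fin.≟ v) then S.A e else 0#)
          + sum (λ e → if does (q e Fin.≟ v) then S.B e else 0#)
      slopeSum-vertex v with s⁺ , s⁻ , right , left , σ≈ ← laplacian z y (vertex v) =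
        -- The slopes supplied by `laplacian` at v agree with the edge slopes A and B by
        -- `slope-unique`.
        trans σ≈ (+-cong
          (sum-cong-≋ {#edges} λ e → if-cong (p e Fin.≟ v) λ p≡v →
            let _ , 0<ε , _ , lin = right e p≡v in slope-unique 0<ε (S.0<εᴬ e) lin (S.right e))
          (sum-cong-≋ {#edges} λ e → if-cong (q e Fin.≟ v) λ q≡v →
            let _ , 0<ε , _ , lin = left e q≡v in slope-unique 0<ε (S.0<εᴮ e) lin (S.left e)))

      edges≈vertices : My - Mz - E ≈ Sz - Sy
      edges≈vertices = begin
        My - Mz - E
          ≈⟨ trans (sum-distrib-minus {#edges} _ _) (+-congʳ (sum-distrib-minus {#edges} _ _)) ⟨
        sum (λ e → mass y e * Y - mass z e * Z
                   - rise φ e * (rise (atVertices z y) e / L e))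
          ≈⟨ sum-cong-≋ {#edges} (λ e → trans (S.green e φ)
               (+-congʳ (proj₂ (proj₂ (proj₂ (edgeSlopes y∥z e))) φ))) ⟨
        sum (λ e → φ (p e) * S.A e + φ (q e) * S.B e)
          ≈⟨ ∑-distrib-+ {#edges} _ _ ⟩
        sum (λ e → φ (p e) * S.A e) + sum (λ e → φ (q e) * S.B e)
          -- Regrouping by vertex: A belongs to the end p e and B to the end q e.
          ≈⟨ +-cong (sum-fibre p φ S.A) (sum-fibre q φ S.B) ⟨
        sum (λ v → φ v * sum (λ e → if does (p e Fin.≟ v) then S.A e else 0#))
          + sum (λ v → φ v * sum (λ e → if does (q e Fin.≟ v) then S.B e else 0#))
          ≈⟨ ∑-distrib-+ {#vertices} _ _ ⟨
        sum (λ v → φ v * sum (λ e → if does (p e Fin.≟ v) then S.A e else 0#)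
                   + φ v * sum (λ e → if does (q e Fin.≟ v) then S.B e else 0#))
          -- The slope sum at v is minus the Laplacian, so the sink enters with a plus sign.
          ≈⟨ sum-cong-≋ {#vertices} (λ v → trans (sym (distribˡ _ _ _))
               (trans (*-congˡ (sym (slopeSum-vertex v)))
                 (solve 3 (λ f a b → f :* (:- (a :- b)) := f :* b :- f :* a) refl
                   (φ v) (δ y (vertex v)) (δ z (vertex v))))) ⟩
        sum (λ v → φ v * δ z (vertex v) - φ v * δ y (vertex v))
          ≈⟨ sum-distrib-minus {#vertices} _ _ ⟩
        Sz - Sy ∎

    -- Both sides are the energy form of the same two voltage functions, evaluated by
    -- `dirichlet-voltage` in either order.
    reciprocity : ∀ {y z y′ z′} → Apart y z → Apart y′ z′ →
      interpolate (atVertices z′ y′) y - interpolate (atVertices z′ y′) z ≈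
      interpolate (atVertices z y) y′ - interpolate (atVertices z y) z′
    reciprocity {y} {z} {y′} {z′} y∥z y′∥z′ = begin
      interpolate (atVertices z′ y′) y - interpolate (atVertices z′ y′) z
        ≈⟨ dirichlet-voltage y∥z (atVertices z′ y′) ⟨
      dirichlet (atVertices z′ y′) (atVertices z y)
        ≈⟨ dirichlet-sym (atVertices z′ y′) (atVertices z y) ⟩
      dirichlet (atVertices z y) (atVertices z′ y′)
        ≈⟨ dirichlet-voltage y′∥z′ (atVertices z y) ⟩
      interpolate (atVertices z y) y′ - interpolate (atVertices z y) z′ ∎

    -- At an interior source the kink is κ = 1, and `evaluate` adds the bump; at a vertex the bump
    -- is zero.
    voltage-at-source : ∀ {y z} → Apart y z →
      j z y y ≈ interpolate (atVertices z y) y + bump y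
    voltage-at-source {vertex _} _ = sym (+-identityʳ _)
    voltage-at-source {y@(interior e t 0<t t<L)} {z} y∥z = begin
      j z y y
        ≈⟨ ContinuousPiecewiseAffine.cong (continuousPiecewiseAffine z y) (at-interior refl) ⟨
      j z (at e t) y
        ≈⟨ EdgeSlopes.evaluate (edgeSlopes-source (y∥z e inside)) ⟩
      interpolate (atVertices z y) y + 1# * bump y
        ≈⟨ +-congˡ (*-identityˡ _) ⟩
      interpolate (atVertices z y) y + bump y ∎

    -- The same evaluation with κ = -1, at the point where the voltage is normalised to zero.
    voltage-at-sink : ∀ {y z} → Apart y z →
      0# ≈ interpolate (atVertices z y) z - bump z
    voltage-at-sink {y} {z@(vertex _)} _ = trans (sym (reference z y)) (sym (x-0≈x _))
    voltage-at-sink {y} {z@(interior e t 0<t t<L)} y∥z = begin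
      0#
        ≈⟨ reference z y ⟨
      j z z y
        ≈⟨ ContinuousPiecewiseAffine.cong (continuousPiecewiseAffine z y) (at-interior refl) ⟨
      j z (at e t) y
        ≈⟨ EdgeSlopes.evaluate (edgeSlopes-sink (λ ∈y → y∥z e ∈y inside)) ⟩
      interpolate (atVertices z y) z + - 1# * bump z
        ≈⟨ solve 2 (λ a b → a :+ :- con (+ 1) :* b := a :- b) refl _ (bump z) ⟩
      interpolate (atVertices z y) z - bump z ∎

    vertex-apart : ∀ {u Q} → Apart (vertex u) Q
    vertex-apart _ ()

    -- Reciprocity with the common sink o, where both voltages vanish.
    voltage-sym : ∀ o u v →
      j (vertex o) (vertex u) (vertex v) ≈ j (vertex o) (vertex v) (vertex u)
    voltage-sym o u v = begin
      J u v              ≈⟨ x-0≈x _ ⟨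
      J u v - 0#         ≈⟨ +-congˡ (-‿cong (reference (vertex o) (vertex v))) ⟨
      J u v - J o v
        ≈⟨ reciprocity {vertex u} {vertex o} {vertex v} {vertex o} vertex-apart vertex-apart ⟩
      J v u - J o u      ≈⟨ +-congˡ (-‿cong (reference (vertex o) (vertex u))) ⟩
      J v u - 0#         ≈⟨ x-0≈x _ ⟩
      J v u              ∎
      where
      J : Vertex → Vertex → Carrier
      J u v = j (vertex o) (vertex u) (vertex v)

    -- Reciprocity expresses f = j_z(·, v) relative to its value at o through J; subtracting the
    -- instance at z, where f vanishes, removes f o.
    voltage-change-reference : ∀ o z u v → let J = λ u v → j (vertex o) (vertex u) (vertex v) in
      j (vertex z) (vertex u) (vertex v) ≈ J v u - J z u - (J v z - J z z)
    voltage-change-reference o z u v = begin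
      f u
        ≈⟨ solve 2 (λ a b → a := a :- b :- (con (+ 0) :- b)) refl (f u) (f o) ⟩
      f u - f o - (0# - f o)
        ≈⟨ +-congˡ (-‿cong (+-congʳ (reference (vertex z) (vertex v)))) ⟨
      f u - f o - (f z - f o)
        ≈⟨ +-cong (step u) (-‿cong (step z)) ⟨
      J v u - J z u - (J v z - J z z) ∎
      where
      J : Vertex → Vertex → Carrier
      J u v = j (vertex o) (vertex u) (vertex v)
      f : Vertex → Carrier
      f u = j (vertex z) (vertex u) (vertex v)
      step : ∀ u → J v u - J z u ≈ f u - f o
      step u = reciprocity {vertex v} {vertex z} {vertex u} {vertex o} vertex-apart vertex-apart

    -- Resistance between points of distinct edges.

    interiorTo-at : ∀ {e e′ t} → InteriorTo e′ (at e t) → e′ ≡ e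
    interiorTo-at {e} {e′} {t} i with compare 0# t | compare t (L e)
    interiorTo-at inside | tri< _ _ _ | tri< _ _ _ = ≡.refl

    at-apart : ∀ {e e′ s t} → e ≢ e′ → Apart (at e s) (at e′ t)
    at-apart e≢e′ e″ ∈e ∈e′ = e≢e′ (≡.trans (≡.sym (interiorTo-at ∈e)) (interiorTo-at ∈e′))

    -- With F = j_Y(·, X) for the two points X and Y, the resistance is F̃(X) - F̃(Y) plus both
    -- bumps. Reciprocity turns the vertex values of F into voltages with reference p e′.
    resistance-between-edges : ∀ {e e′} → e ≢ e′ → ∀ {x y} →
      0# ≤ x → x ≤ L e → 0# ≤ y → y ≤ L e′ →
      let J = λ u v → j (vertex (p e′)) (vertex u) (vertex v)
          t = x / L e
          s = y / L e′
          a = J (p e) (p e)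
          b = J (q e) (p e)
          d = J (q e) (q e)
          g = J (p e) (q e′)
          h = J (q e) (q e′)
          k = J (q e′) (q e′)
      in
      resistance j (at e x) (at e′ y) ≈
        (1# - t) * (a + t * (b - a) - s * g)
        + t * (b + t * (d - b) - s * h)
        - s * (g + t * (h - g) - s * k)
        + x * (L e - x) / L e + y * (L e′ - y) / L e′
    resistance-between-edges {e} {e′} e≢e′ {x} {y} 0≤x x≤L 0≤y y≤L′ = begin
      resistance j X Y
        ≈⟨ voltage-at-source X∥Y ⟩
      interpolate F X + bump X
        -- The subtracted zero is the voltage at the sink, whose expansion brings in the bump of Y.
        ≈⟨ x-0≈x _ ⟨
      interpolate F X + bump X - 0#
        ≈⟨ +-congˡ (-‿cong (voltage-at-sink X∥Y)) ⟩
      interpolate F X + bump X - (interpolate F Y - bump Y)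
        ≈⟨ +-cong (+-cong (interpolate-at F e 0≤x x≤L) (bump-at e 0≤x x≤L))
             (-‿cong (+-cong (interpolate-at F e′ 0≤y y≤L′) (-‿cong (bump-at e′ 0≤y y≤L′)))) ⟩
      F (p e) + t * rise F e + βₓ - (F o + s * rise F e′ - βᵧ)
        -- The coefficients of the four values of F add up to zero, so F o may be subtracted from
        -- each value.
        ≈⟨ solve 8 (λ P Q O R t s β γ →
             P :+ t :* (Q :- P) :+ β :- (O :+ s :* (R :- O) :- γ) :=
             (con (+ 1) :- t) :* (P :- O) :+ t :* (Q :- O) :- s :* (R :- O) :+ β :+ γ)
             refl (F (p e)) (F (q e)) (F o) (F (q e′)) t s βₓ βᵧ ⟩
      (1# - t) * (F (p e) - F o) + t * (F (q e) - F o) - s * (F (q e′) - F o) + βₓ + βᵧ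
        ≈⟨ +-congʳ (+-congʳ (+-cong
             (+-cong (*-congˡ (F-difference (p e) refl refl (voltage-sym o _ _)))
                     (*-congˡ (F-difference (q e) (voltage-sym o _ _) refl (voltage-sym o _ _))))
             (-‿cong (*-congˡ (F-difference (q e′) refl refl refl))))) ⟩
      _ ∎
      where
      X = at e x
      Y = at e′ y
      o = p e′
      t = x / L e
      s = y / L e′
      βₓ = x * (L e - x) / L e
      βᵧ = y * (L e′ - y) / L e′
      F = atVertices Y X
      J : Vertex → Vertex → Carrier
      J u v = j (vertex o) (vertex u) (vertex v)
      X∥Y : Apart X Y
      X∥Y = at-apart e≢e′

      -- Reciprocity against the pair v, o. The values a, b, g are parameters so that `voltage-sym`
      -- can order the arguments of J uniformly.
      F-difference : ∀ v {a b g} → J (p e) v ≈ a → J (q e) v ≈ b → J (q e′) v ≈ g →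
                     F v - F o ≈ a + t * (b - a) - s * g
      F-difference v {a} {b} {g} a≈ b≈ g≈ = begin
        F v - F o
          ≈⟨ reciprocity {y′ = vertex v} {vertex o} X∥Y vertex-apart ⟨
        interpolate (atVertices (vertex o) (vertex v)) X
          - interpolate (atVertices (vertex o) (vertex v)) Y
          ≈⟨ +-cong (interpolate-at _ e 0≤x x≤L) (-‿cong (interpolate-at _ e′ 0≤y y≤L′)) ⟩
        J (p e) v + t * (J (q e) v - J (p e) v) - (J o v + s * (J (q e′) v - J o v))
          ≈⟨ +-cong (+-cong a≈ (*-congˡ (+-cong b≈ (-‿cong a≈))))
               (-‿cong (+-cong o≈ (*-congˡ (+-cong g≈ (-‿cong o≈))))) ⟩
        a + t * (b - a) - (0# + s * (g - 0#))
          ≈⟨ solve 3 (λ c s g → c :- (con (+ 0) :+ s :* (g :- con (+ 0))) := c :- s :* g)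
               refl (a + t * (b - a)) s g ⟩
        a + t * (b - a) - s * g ∎
        where o≈ = reference (vertex o) (vertex v)

-- Conversion to the stated resistances and voltages.

theorem3p3 :
    ∀ {c ℓ₁ ℓ₂} (K : OrderedField c ℓ₁ ℓ₂) (Γ : MetrizedGraph K) →
    let open OrderedField K
        open MetrizedGraph Γ
        open Circuit Γ
    in
    (j : Point → Point → Point → Carrier) → IsVoltageFunction j →
    (eᵢ eⱼ : Edge) → eᵢ ≢ eⱼ →
    (x y : Carrier) → 0# ≤ x → x ≤ L eᵢ → 0# ≤ y → y ≤ L eⱼ →
    let r  = resistance j
        Lᵢ = L eᵢ
        Lⱼ = L eⱼ
        pᵢ = vertex (p eᵢ)
        qᵢ = vertex (q eᵢ)
        pⱼ = vertex (p eⱼ)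
        qⱼ = vertex (q eⱼ)
    in
    r (at eᵢ x) (at eⱼ y)
      ≈ - (x * x * ((Lᵢ - r pᵢ qᵢ) / (Lᵢ * Lᵢ)))
        - y * y * ((Lⱼ - r pⱼ qⱼ) / (Lⱼ * Lⱼ))
        + (2# * x * y) / (Lᵢ * Lⱼ) * (j pⱼ pᵢ qⱼ - j pⱼ qᵢ qⱼ)
        + x / Lᵢ * (Lᵢ - 2# * j pᵢ qᵢ pⱼ)
        + y / Lⱼ * (Lⱼ - 2# * j pⱼ pᵢ qⱼ)
        + r pᵢ pⱼ
theorem3p3 K Γ j V eᵢ eⱼ eᵢ≢eⱼ x y 0≤x x≤Lᵢ 0≤y y≤Lⱼ = begin
  resistance j (at eᵢ x) (at eⱼ y)
    ≈⟨ resistance-between-edges V eᵢ≢eⱼ 0≤x x≤Lᵢ 0≤y y≤Lⱼ ⟩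
  _
    -- The identity holds modulo Lᵢ Lᵢ⁻¹ = 1 = Lⱼ Lⱼ⁻¹, whence the last two terms.
    ≈⟨ solve 12 (λ x u l y v m a b d g h k →
         let t = x :* u ; s = y :* v ; 2′ = con (+ 2) in
         (con (+ 1) :- t) :* (a :+ t :* (b :- a) :- s :* g)
         :+ t :* (b :+ t :* (d :- b) :- s :* h)
         :- s :* (g :+ t :* (h :- g) :- s :* k)
         :+ x :* (l :- x) :* u :+ y :* (m :- y) :* v
         := :- (x :* x :* ((l :- (a :- b :- (b :- d))) :* (u :* u)))
            :- y :* y :* ((m :- k) :* (v :* v))
            :+ 2′ :* x :* y :* (u :* v) :* (g :- h)
            :+ t :* (l :- 2′ :* (a :- b))
            :+ s :* (m :- 2′ :* g)
            :+ a
            :+ x :* x :* u :* (l :* u :- con (+ 1))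
            :+ y :* y :* v :* (m :* v :- con (+ 1)))
         refl x (Lᵢ ⁻¹) Lᵢ y (Lⱼ ⁻¹) Lⱼ a b d g h k ⟩
  _
    ≈⟨ +-cong (+-congˡ (x*[L/L-1]≈0 (x * x / Lᵢ) eᵢ)) (x*[L/L-1]≈0 (y * y / Lⱼ) eⱼ) ⟩
  _ + 0# + 0#
    ≈⟨ trans (+-identityʳ _) (+-identityʳ _) ⟩
  _
    -- Products of inverses become inverses of products, and a, b, d, k are traded for resistances
    -- and a voltage. The remaining a, g and h are `r pᵢ pⱼ`, `j pⱼ pᵢ qⱼ` and `j pⱼ qᵢ qⱼ` by
    -- definition.
    ≈⟨ +-congʳ (+-congʳ (+-cong (+-cong (+-cong
         (-‿cong (*-congˡ (*-cong (+-congˡ (-‿cong rᵢ≈)) (⁻¹-distrib-* (L>0 eᵢ) (L>0 eᵢ)))))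
         (-‿cong (*-congˡ (*-cong (+-congˡ (-‿cong rⱼ≈)) (⁻¹-distrib-* (L>0 eⱼ) (L>0 eⱼ))))))
         (*-congʳ (*-congˡ (⁻¹-distrib-* (L>0 eᵢ) (L>0 eⱼ)))))
         (*-congˡ (+-congˡ (-‿cong (*-congˡ jᵢ≈)))))) ⟨
  _ ∎
  where
  open OrderedField K
  open MetrizedGraph Γ
  open Circuit Γ
  open OrderedFieldProperties K
  open CircuitProperties Γ
  open CommutativeRing commutativeRing using (refl; sym; trans)
  open IntegerCoefficients commutativeRing using (module Solver)
  open Solver using (solve; _:=_; _:+_; _:*_; _:-_; :-_; con)
  open import Relation.Binary.Reasoning.Setoid setoid

  Lᵢ = L eᵢ
  Lⱼ = L eⱼ
  J : Vertex → Vertex → Carrier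
  J u v = j (vertex (p eⱼ)) (vertex u) (vertex v)
  a = J (p eᵢ) (p eᵢ)
  b = J (q eᵢ) (p eᵢ)
  d = J (q eᵢ) (q eᵢ)
  g = J (p eᵢ) (q eⱼ)
  h = J (q eᵢ) (q eⱼ)
  k = J (q eⱼ) (q eⱼ)

  J-pⱼˡ : ∀ v → J (p eⱼ) v ≈ 0#
  J-pⱼˡ v = IsVoltageFunction.reference V (vertex (p eⱼ)) (vertex v)

  -- The polarisation identity r(p, q) = J p p - 2 J p q + J q q.
  rᵢ≈ : resistance j (vertex (p eᵢ)) (vertex (q eᵢ)) ≈ a - b - (b - d)
  rᵢ≈ = trans (voltage-change-reference V (p eⱼ) (q eᵢ) (p eᵢ) (p eᵢ))
    (+-congˡ (-‿cong (+-congʳ (voltage-sym V (p eⱼ) (p eᵢ) (q eᵢ)))))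

  -- Three of the four voltages have the reference p eⱼ as an argument and vanish.
  rⱼ≈ : resistance j (vertex (p eⱼ)) (vertex (q eⱼ)) ≈ k
  rⱼ≈ = begin
    resistance j (vertex (p eⱼ)) (vertex (q eⱼ))
      ≈⟨ voltage-change-reference V (p eⱼ) (q eⱼ) (p eⱼ) (p eⱼ) ⟩
    J (p eⱼ) (p eⱼ) - J (q eⱼ) (p eⱼ) - (J (p eⱼ) (q eⱼ) - k)
      ≈⟨ +-cong (+-cong (J-pⱼˡ _) (-‿cong (trans (voltage-sym V (p eⱼ) _ _) (J-pⱼˡ _))))
                (-‿cong (+-congʳ (J-pⱼˡ _))) ⟩
    0# - 0# - (0# - k)
      ≈⟨ solve 1 (λ k → con (+ 0) :- con (+ 0) :- (con (+ 0) :- k) := k) refl k ⟩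
    k ∎

  jᵢ≈ : j (vertex (p eᵢ)) (vertex (q eᵢ)) (vertex (p eⱼ)) ≈ a - b
  jᵢ≈ = begin
    j (vertex (p eᵢ)) (vertex (q eᵢ)) (vertex (p eⱼ))
      ≈⟨ voltage-change-reference V (p eⱼ) (p eᵢ) (q eᵢ) (p eⱼ) ⟩
    J (p eⱼ) (q eᵢ) - J (p eᵢ) (q eᵢ) - (J (p eⱼ) (p eᵢ) - a)
      ≈⟨ +-cong (+-cong (J-pⱼˡ _) (-‿cong (voltage-sym V (p eⱼ) _ _)))
                (-‿cong (+-congʳ (J-pⱼˡ _))) ⟩
    0# - b - (0# - a)
      ≈⟨ solve 2 (λ a b → con (+ 0) :- b :- (con (+ 0) :- a) := a :- b) refl a b ⟩
    a - b ∎

  x*[L/L-1]≈0 : ∀ x e → x * (L e / L e - 1#) ≈ 0#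
  x*[L/L-1]≈0 x e = begin
    x * (L e / L e - 1#)   ≈⟨ *-congˡ (+-congʳ (L*L⁻¹≈1 e)) ⟩
    x * (1# - 1#)          ≈⟨ solve 1 (λ x → x :* (con (+ 1) :- con (+ 1)) := con (+ 0)) refl x ⟩
    0#                     ∎
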